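{- For any bounded lattice $L$ and binary operation $\to$ on $L$, the following are equivalent: 1. $\to$ is a preconditional such that $a\wedge(a\to 0)=0$ and $(a\to 0)\to 0=a$ for all $a\in L$; 2. $L$ equipped with the unary operation $\neg$ defined by $\neg a:=a\to 0$ is an ortholattice, and $\to$ coincides with the Sasaki hook, i.e., $a\to b=\neg a\vee(a\wedge b)$ for all $a,b\in L$.
   Context: A preconditional on a bounded lattice $L$ is a binary operation $\to$ on $L$ such that for all $a,b,c\in L$: (1) $1\to a\leq a$; (2) $a\wedge b\leq a\to b$; (3) $a\to b\leq a\to(a\wedge b)$; (4) $a\to(b\wedge c)\leq a\to b$; (5) $a\to((a\wedge b)\to c)\leq (a\wedge b)\to c$. An ortholattice is a bounded lattice equipped with a unary operation $\neg$ (an orthocomplementation) satisfying antitonicity ($a\leq b$ implies $\neg b\leq\neg a$), semicomplementation ($a\wedge\neg a=0$), and involution ($\neg\neg a=a$). -}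

module Defs where

open import Algebra.Core using (Op₁; Op₂)
open import Level using (Level; _⊔_)
open import Relation.Binary.Lattice using (BoundedLattice)

module _ {c ℓ₁ ℓ₂ : Level} (L : BoundedLattice c ℓ₁ ℓ₂) where

  open BoundedLattice L

  record IsPreconditional (_⇒_ : Op₂ Carrier) : Set (c ⊔ ℓ₂) where
    field
      ⊤⇒-elim  : ∀ a → (⊤ ⇒ a) ≤ a
      ∧≤⇒      : ∀ a b → (a ∧ b) ≤ (a ⇒ b)
      ⇒≤⇒∧     : ∀ a b → (a ⇒ b) ≤ (a ⇒ (a ∧ b))
      ⇒∧≤⇒     : ∀ a b c → (a ⇒ (b ∧ c)) ≤ (a ⇒ b)
      ⇒[∧⇒]≤∧⇒ : ∀ a b c → (a ⇒ ((a ∧ b) ⇒ c)) ≤ ((a ∧ b) ⇒ c)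

  -- The bounded lattice L equipped with ¬_ is an ortholattice.  Antitonicity
  -- makes ¬_ respect _≈_, so no separate congruence field is needed.
  record IsOrtholattice (¬_ : Op₁ Carrier) : Set (c ⊔ ℓ₁ ⊔ ℓ₂) where
    field
      antitone            : ∀ a b → a ≤ b → (¬ b) ≤ (¬ a)
      semicomplementation : ∀ a → (a ∧ (¬ a)) ≈ ⊥
      involutive          : ∀ a → (¬ (¬ a)) ≈ a

  sasakiHook : Op₁ Carrier → Op₂ Carrier
  sasakiHook ¬_ a b = (¬ a) ∨ (a ∧ b)

{-# OPTIONS --safe #-}

-- In a preconditional, a ⇒_ is monotone, so axiom (5) with c = ⊥ gives
-- a ⇒ ¬ (a ∧ d) ≤ ¬ (a ∧ d).  With d = b this makes ¬ antitone, since
-- ¬ a ≤ a ⇒ ¬ (a ∧ b).  With d = ¬ (a ∧ b), De Morgan identifies ¬ (a ∧ d)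
-- with the Sasaki hook of a and b, and a ⇒ b ≤ a ⇒ (a ∧ b) ≤ a ⇒ ¬ (a ∧ d).

module Submission where

open import Defs using (IsPreconditional; IsOrtholattice; sasakiHook)
open import Algebra.Core using (Op₁; Op₂)
open import Algebra.Definitions using (Congruent₂)
open import Data.Product using (_×_; _,_)
open import Function.Bundles using (_⇔_; mk⇔)
open import Level using (Level)
open import Relation.Binary.Lattice using (BoundedLattice)
import Relation.Binary.Lattice.Properties.JoinSemilattice as JoinSemilatticeProperties
import Relation.Binary.Lattice.Properties.MeetSemilattice as MeetSemilatticeProperties
import Relation.Binary.Reasoning.PartialOrder as PartialOrderReasoning

module _ {c ℓ₁ ℓ₂ : Level} (L : BoundedLattice c ℓ₁ ℓ₂) where

  open BoundedLattice L
  open JoinSemilatticeProperties joinSemilattice using (∨-monotonic)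
  open MeetSemilatticeProperties meetSemilattice
    using (∧-monotonic; y≤x⇒x∧y≈y)
  open PartialOrderReasoning poset

  module OrtholatticeProperties {¬_ : Op₁ Carrier} (O : IsOrtholattice L ¬_) where

    open IsOrtholattice O

    ¬⊤≤⊥ : (¬ ⊤) ≤ ⊥
    ¬⊤≤⊥ = begin
      ¬ ⊤        ≤⟨ ∧-greatest (maximum _) refl ⟩
      ⊤ ∧ (¬ ⊤)  ≈⟨ semicomplementation ⊤ ⟩
      ⊥          ∎

    -- By antitonicity and involution it suffices to bound `¬ ((¬ a) ∨ b)` by each of `a` and `¬ b`;
    -- each bound negates one inclusion into the join.
    ¬[a∧¬b]≤¬a∨b : ∀ a b → (¬ (a ∧ (¬ b))) ≤ ((¬ a) ∨ b)
    ¬[a∧¬b]≤¬a∨b a b = begin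
      ¬ (a ∧ (¬ b))      ≤⟨ antitone _ _ (∧-greatest ¬[¬a∨b]≤a ¬[¬a∨b]≤¬b) ⟩
      ¬ (¬ ((¬ a) ∨ b))  ≈⟨ involutive _ ⟩
      (¬ a) ∨ b          ∎
      where
      ¬[¬a∨b]≤a : (¬ ((¬ a) ∨ b)) ≤ a
      ¬[¬a∨b]≤a = trans (antitone _ _ (x≤x∨y _ _)) (reflexive (involutive a))

      ¬[¬a∨b]≤¬b : (¬ ((¬ a) ∨ b)) ≤ (¬ b)
      ¬[¬a∨b]≤¬b = antitone _ _ (y≤x∨y _ _)

    -- Instantiated at `a ∧ b`, this weakens a consequent to the negation of a meet with `a`, the
    -- shape that axiom (5) with `c = ⊥` absorbs.
    b≤¬[a∧¬b] : ∀ a b → b ≤ (¬ (a ∧ (¬ b)))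
    b≤¬[a∧¬b] a b = begin
      b              ≈⟨ involutive b ⟨
      ¬ (¬ b)        ≤⟨ antitone _ _ (x∧y≤y _ _) ⟩
      ¬ (a ∧ (¬ b))  ∎

  module _ {_⇒_ : Op₂ Carrier} (⇒-cong : Congruent₂ _≈_ _⇒_) where

    private
      ¬_ : Op₁ Carrier
      ¬ a = a ⇒ ⊥

    module PreconditionalProperties (P : IsPreconditional L _⇒_) where

      open IsPreconditional P

      -- The hypothesis makes `b` the meet `d ∧ b` up to `_≈_`, and axiom (4) drops its second
      -- factor.
      ⇒-monoʳ : ∀ a {b d} → b ≤ d → (a ⇒ b) ≤ (a ⇒ d)
      ⇒-monoʳ a {b} {d} b≤d = begin
        a ⇒ b        ≈⟨ ⇒-cong Eq.refl (y≤x⇒x∧y≈y b≤d) ⟨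
        a ⇒ (d ∧ b)  ≤⟨ ⇒∧≤⇒ a d b ⟩
        a ⇒ d        ∎

      ¬-antitone : ∀ a b → a ≤ b → (¬ b) ≤ (¬ a)
      ¬-antitone a b a≤b = begin
        b ⇒ ⊥              ≤⟨ ⇒-monoʳ b (minimum _) ⟩
        b ⇒ ((b ∧ a) ⇒ ⊥)  ≤⟨ ⇒[∧⇒]≤∧⇒ b a ⊥ ⟩
        (b ∧ a) ⇒ ⊥        ≈⟨ ⇒-cong (y≤x⇒x∧y≈y a≤b) Eq.refl ⟩
        a ⇒ ⊥              ∎

      isOrtholattice : (∀ a → (a ∧ (¬ a)) ≈ ⊥) → (∀ a → (¬ (¬ a)) ≈ a) →
                       IsOrtholattice L ¬_
      isOrtholattice a∧¬a≈⊥ ¬¬a≈a = record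
        { antitone            = ¬-antitone
        ; semicomplementation = a∧¬a≈⊥
        ; involutive          = ¬¬a≈a
        }

      -- The joinand `¬ a` is `a ⇒ ⊥`, so monotonicity bounds it; axiom (2) bounds the other.
      sasakiHook≤⇒ : ∀ a b → sasakiHook L ¬_ a b ≤ (a ⇒ b)
      sasakiHook≤⇒ a b = ∨-least (⇒-monoʳ a (minimum b)) (∧≤⇒ a b)

      ⇒≤sasakiHook : IsOrtholattice L ¬_ → ∀ a b → (a ⇒ b) ≤ sasakiHook L ¬_ a b
      ⇒≤sasakiHook O a b = begin
        a ⇒ b                          ≤⟨ ⇒≤⇒∧ a b ⟩
        a ⇒ (a ∧ b)                    ≤⟨ ⇒-monoʳ a (b≤¬[a∧¬b] a (a ∧ b)) ⟩
        a ⇒ ((a ∧ (¬ (a ∧ b))) ⇒ ⊥)    ≤⟨ ⇒[∧⇒]≤∧⇒ a (¬ (a ∧ b)) ⊥ ⟩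
        ¬ (a ∧ (¬ (a ∧ b)))            ≤⟨ ¬[a∧¬b]≤¬a∨b a (a ∧ b) ⟩
        (¬ a) ∨ (a ∧ b)                ∎
        where open OrtholatticeProperties O

  sasakiHook-isPreconditional : ∀ {¬_ : Op₁ Carrier} {_⇒_ : Op₂ Carrier} →
    IsOrtholattice L ¬_ → (∀ a b → (a ⇒ b) ≈ sasakiHook L ¬_ a b) →
    IsPreconditional L _⇒_
  sasakiHook-isPreconditional {¬_} {_⇒_} O ⇒≈hook = record
    { ⊤⇒-elim  = λ a → begin
        ⊤ ⇒ a            ≈⟨ ⇒≈hook ⊤ a ⟩
        -- Semicomplementation at `⊤` collapses `¬ ⊤`, so only `⊤ ∧ a` contributes.
        (¬ ⊤) ∨ (⊤ ∧ a)  ≤⟨ ∨-least (trans ¬⊤≤⊥ (minimum a)) (x∧y≤y ⊤ a) ⟩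
        a                ∎
    ; ∧≤⇒      = λ a b → begin
        a ∧ b            ≤⟨ y≤x∨y _ _ ⟩
        (¬ a) ∨ (a ∧ b)  ≈⟨ ⇒≈hook a b ⟨
        a ⇒ b            ∎
    ; ⇒≤⇒∧     = λ a b → ⇒-mono a (∧-greatest (x∧y≤x a b) refl)
    ; ⇒∧≤⇒     = λ a b d → ⇒-mono a (∧-monotonic refl (x∧y≤x b d))
    ; ⇒[∧⇒]≤∧⇒ = λ a b d → begin
        a ⇒ ((a ∧ b) ⇒ d)            ≈⟨ ⇒≈hook _ _ ⟩
        -- The inner implication already is the target, so the meet projects onto it; `¬ a` lies
        -- below the target's joinand `¬ (a ∧ b)`.
        (¬ a) ∨ (a ∧ ((a ∧ b) ⇒ d))  ≤⟨ ∨-least (¬a≤[a∧b]⇒d a b d) (x∧y≤y _ _) ⟩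
        (a ∧ b) ⇒ d                  ∎
    }
    where
    open IsOrtholattice O
    open OrtholatticeProperties O

    -- The hook sees its second argument only through the meet with `a`. Comparing these meets,
    -- rather than `b` and `d`, covers axiom (3), where `b ≤ a ∧ b` may fail.
    ⇒-mono : ∀ a {b d} → (a ∧ b) ≤ (a ∧ d) → (a ⇒ b) ≤ (a ⇒ d)
    ⇒-mono a {b} {d} a∧b≤a∧d = begin
      a ⇒ b            ≈⟨ ⇒≈hook a b ⟩
      (¬ a) ∨ (a ∧ b)  ≤⟨ ∨-monotonic refl a∧b≤a∧d ⟩
      (¬ a) ∨ (a ∧ d)  ≈⟨ ⇒≈hook a d ⟨
      a ⇒ d            ∎

    ¬a≤[a∧b]⇒d : ∀ a b d → (¬ a) ≤ ((a ∧ b) ⇒ d)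
    ¬a≤[a∧b]⇒d a b d = begin
      ¬ a                          ≤⟨ antitone _ _ (x∧y≤x a b) ⟩
      ¬ (a ∧ b)                    ≤⟨ x≤x∨y _ _ ⟩
      (¬ (a ∧ b)) ∨ ((a ∧ b) ∧ d)  ≈⟨ ⇒≈hook (a ∧ b) d ⟨
      (a ∧ b) ⇒ d                  ∎

proposition4 : ∀ {c ℓ₁ ℓ₂ : Level} (L : BoundedLattice c ℓ₁ ℓ₂) →
    let open BoundedLattice L in
    (_⇒_ : Op₂ Carrier) → Congruent₂ _≈_ _⇒_ →
    (IsPreconditional L _⇒_
    × (∀ a → (a ∧ (a ⇒ ⊥)) ≈ ⊥)
    × (∀ a → ((a ⇒ ⊥) ⇒ ⊥) ≈ a))
    ⇔
    (IsOrtholattice L (λ a → a ⇒ ⊥)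
    × (∀ a b → (a ⇒ b) ≈ sasakiHook L (λ x → x ⇒ ⊥) a b))
proposition4 L _⇒_ ⇒-cong = mk⇔
  (λ (P , a∧¬a≈⊥ , ¬¬a≈a) →
    let open PreconditionalProperties L ⇒-cong P
        O = isOrtholattice a∧¬a≈⊥ ¬¬a≈a
    in O , λ a b → antisym (⇒≤sasakiHook O a b) (sasakiHook≤⇒ a b))
  (λ (O , ⇒≈hook) →
    let open IsOrtholattice O
    -- Since `¬ a` is `a ⇒ ⊥`, both side conditions are ortholattice axioms verbatim.
    in sasakiHook-isPreconditional L O ⇒≈hook , semicomplementation , involutive)
  where open BoundedLattice L using (antisym)
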